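{- Let $1 \leq t \leq k_1\leq k_2\leq \cdots \leq k_r \leq n$ be integers. There exists $n_0(k_{r-1},k_{r},t)$ such that the following holds for all $n\geq n_0(k_{r-1},k_{r},t)$. Let $\mathcal{F}_1, \mathcal{F}_2, \ldots, \mathcal{F}_r$ be families of subsets of $[n]=\{1,\ldots,n\}$, where every member of $\mathcal{F}_i$ has size at most $k_i$. If for all $i,j\in[r]$, every $A \in \mathcal{F}_i$ and $B \in \mathcal{F}_j$ with $|A \cap B| <t$ satisfy $|A\triangle B| \leq \min\{k_i,k_j\} -t$, then $$ \prod_{i=1}^r |\mathcal{F}_i| \leq \prod_{i=1}^{r}\left(\sum_{j=0}^{k_i-t} \binom{n-t}{k_i-t-j} \right).$$
   Context: $A\triangle B$ denotes the symmetric difference of $A$ and $B$. -}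

module Defs where

open import Data.Nat using (ℕ; zero; suc; _+_; _*_; _∸_)
open import Data.Nat.Combinatorics using (_C_)
open import Data.Fin using (Fin)
open import Data.Fin.Subset using (Subset; _∪_; _─_)
open import Data.List using (List; tabulate)
open import Data.Nat.ListAction using (product)

_△_ : ∀ {n} → Subset n → Subset n → Subset n
A △ B = (A ─ B) ∪ (B ─ A)

sumBinom : ℕ → ℕ → ℕ
sumBinom N zero = N C 0
sumBinom N (suc d) = N C (suc d) + sumBinom N d

prodFin : ∀ {r} → (Fin r → ℕ) → ℕ
prodFin f = product (tabulate f)

{-# OPTIONS --safe #-}
module Submission where

-- Each family can be bounded separately. Let F be a family of sets of size at
-- most k satisfying the hypothesis with itself, and put d = k ∸ t. Then
-- ∣ B ─ A ∣ ≤ d for all A, B in F. Either the members of F share a set of size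
-- at least t, which gives the claimed bound, or d = 0 and F has at most one
-- member, or there is a set W of size bounded in terms of k with ∣ B ─ W ∣ < d
-- for all B in F. In the last case F has O(n ^ (d ∸ 1)) members, fewer than the
-- bound once n is large.
--
-- To find W, fix A₀ in F. A member B of size k meets every member in at least
-- t elements. If there is no common core, the trace T = B ∩ A₀ fails to be
-- contained in some A in F, so B meets A₀ ∪ A in more than t elements; W
-- collects such an A for each of the boundedly many traces T. A member B of
-- size less than k with ∣ B ─ A₀ ∣ = d has size d + ∣ A₀ ∣, and it suffices to
-- add a single such member A₁ to W: for another one, ∣ B ─ A₁ ∣ = d would force
-- size d + ∣ A₁ ∣, which is larger.

open import Defs
open import Data.Empty using (⊥-elim)
open import Data.Nat using (ℕ; zero; suc; _+_; _*_; _^_; _≤_; _<_; _∸_; _⊓_; z≤n; s≤s; _≤?_; _<?_; _≟_)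
open import Data.Nat.Combinatorics using (_C_; nCn≡1; nC1≡n; nCk≡nC[n∸k]; nCk+nC[k+1]≡[n+1]C[k+1]; k>n⇒nCk≡0)
open import Data.Nat.Properties
open import Data.Nat.Solver using (module +-*-Solver)
open import Data.Fin using (Fin; zero; fromℕ; inject₁) renaming (suc to fsuc)
open import Data.Fin.Properties using (any?)
open import Data.Fin.Subset using (Subset; inside; outside; _∩_; _∪_; _─_; ∁; ⊥; ∣_∣; _⊆_) renaming (_∈_ to _∈ˢ_; _∉_ to _∉ˢ_)
open import Data.Fin.Subset.Properties using (_∈?_; drop-∷-⊆; p⊆q⇒∣p∣≤∣q∣; p⊂q⇒∣p∣<∣q∣; ∣⊥∣≡0; ∣∁p∣≡n∸∣p∣; ∩-comm; p∩q⊆p; p∩q⊆q; x∈p∩q⁺; x∈p∩q⁻; ⊆-trans; ⊥⊆; p⊆p∪q; q⊆p∪q; p─⊥≡p; ∣p─q∣≤∣p∣)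
open import Data.List using (List; []; _∷_; length; map; _++_)
open import Data.List.Properties using (length-++; length-map)
open import Data.List.Membership.Propositional using (_∈_; find)
open import Data.List.Membership.Propositional.Properties using (∈-∃++; ∈-++⁻; ∈-++⁺ˡ; ∈-++⁺ʳ; ∈-map⁺)
open import Data.List.Relation.Unary.All as All using (All; []; _∷_)
import Data.List.Relation.Unary.Any as Any
open import Data.List.Relation.Unary.Any using (here; there)
open import Data.List.Relation.Unary.AllPairs using ([]; _∷_)
open import Data.List.Relation.Unary.Unique.Propositional using (Unique)
open import Data.Product using (Σ; ∃; _×_; _,_; proj₁; proj₂)
open import Data.Sum using (_⊎_; inj₁; inj₂)
open import Data.Vec using ([]; _∷_; here; there)
open import Function using (_∘_)
open import Relation.Binary.PropositionalEquality using (_≡_; refl; sym; trans; cong; cong₂; subst; module ≡-Reasoning)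
open import Relation.Nullary using (yes; no; ¬?; _×-dec_)
open import Relation.Nullary.Decidable using (decidable-stable)
open +-*-Solver using (solve; _:+_; _:*_; _:=_; con)

-- Binomial sums

nC0≡1 : ∀ n → n C 0 ≡ 1
nC0≡1 n = trans (nCk≡nC[n∸k] {0} {n} z≤n) (nCn≡1 n)

sumBinom-pascal : ∀ N e → sumBinom (suc N) (suc e) ≡ sumBinom N (suc e) + sumBinom N e
sumBinom-pascal N zero
  rewrite sym (nCk+nC[k+1]≡[n+1]C[k+1] N 0) | nC0≡1 (suc N) | nC0≡1 N
  = solve 1 (λ x → (con 1 :+ x) :+ con 1 := (x :+ con 1) :+ con 1) refl (N C 1)
sumBinom-pascal N (suc e)
  rewrite sym (nCk+nC[k+1]≡[n+1]C[k+1] N (suc e)) | sumBinom-pascal N e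
  = solve 4 (λ c c′ s s′ → (c :+ c′) :+ ((c :+ s) :+ s′) := (c′ :+ (c :+ s)) :+ (c :+ s′)) refl
      (N C suc e) (N C suc (suc e)) (sumBinom N e) (sumBinom N e)

sumBinom-monoʳ : ∀ N e → sumBinom N e ≤ sumBinom N (suc e)
sumBinom-monoʳ N e = m≤n+m _ _

sumBinom-suc-mono : ∀ N e → sumBinom N e ≤ sumBinom (suc N) e
sumBinom-suc-mono N zero = ≤-reflexive (trans (nC0≡1 N) (sym (nC0≡1 (suc N))))
sumBinom-suc-mono N (suc e) rewrite sumBinom-pascal N e = m≤m+n _ _

sumBinom-monoˡ : ∀ {M N} e → M ≤ N → sumBinom M e ≤ sumBinom N e
sumBinom-monoˡ {M} e M≤N = subst (λ x → sumBinom M e ≤ sumBinom x e) (m∸n+n≡m M≤N) (go _)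
  where
  go : ∀ p → sumBinom M e ≤ sumBinom (p + M) e
  go zero    = ≤-refl
  go (suc p) = ≤-trans (go p) (sumBinom-suc-mono (p + M) e)

-- By Pascal's rule, raising the upper index by one at most doubles the sum. This is the price of
-- replacing `n` by `n ∸ t` in `cover-bound`.
sumBinom-shift : ∀ p N e → sumBinom (p + N) e ≤ 2 ^ p * sumBinom N e
sumBinom-shift zero    N e = ≤-reflexive (sym (+-identityʳ _))
sumBinom-shift (suc p) N e = begin
  sumBinom (suc (p + N)) e   ≤⟨ double (p + N) e ⟩
  2 * sumBinom (p + N) e     ≤⟨ *-monoʳ-≤ 2 (sumBinom-shift p N e) ⟩
  2 * (2 ^ p * sumBinom N e) ≡⟨ *-assoc 2 (2 ^ p) _ ⟨
  2 ^ suc p * sumBinom N e   ∎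
  where
  open ≤-Reasoning
  double : ∀ N e → sumBinom (suc N) e ≤ 2 * sumBinom N e
  double N zero rewrite nC0≡1 (suc N) | nC0≡1 N = s≤s z≤n
  double N (suc e) rewrite sumBinom-pascal N e | +-identityʳ (sumBinom N (suc e)) =
    +-monoʳ-≤ (sumBinom N (suc e)) (sumBinom-monoʳ N e)

nC-absorb : ∀ N j → suc j * (N C suc j) + j * (N C j) ≡ N * (N C j)
nC-absorb zero zero = refl
nC-absorb zero (suc j)
  rewrite k>n⇒nCk≡0 {0} {suc j} (s≤s z≤n) | k>n⇒nCk≡0 {0} {suc (suc j)} (s≤s z≤n)
  | *-zeroʳ j = refl
nC-absorb (suc N) zero rewrite nC1≡n (suc N) | nC0≡1 (suc N) =
  solve 1 (λ x → (con 1 :+ x) :+ con 0 :+ con 0 := (con 1 :+ x) :* con 1) refl N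
nC-absorb (suc N) (suc i)
  rewrite sym (nCk+nC[k+1]≡[n+1]C[k+1] N i) | sym (nCk+nC[k+1]≡[n+1]C[k+1] N (suc i)) = begin
  (2 + i) * (c₁ + c₂) + (1 + i) * (c₀ + c₁)
    ≡⟨ solve 4 (λ i c₀ c₁ c₂ →
         (con 2 :+ i) :* (c₁ :+ c₂) :+ (con 1 :+ i) :* (c₀ :+ c₁)
         := ((con 2 :+ i) :* c₂ :+ (con 1 :+ i) :* c₁)
            :+ (((con 1 :+ i) :* c₁ :+ i :* c₀) :+ (c₁ :+ c₀)))
         refl i c₀ c₁ c₂ ⟩
  ((2 + i) * c₂ + (1 + i) * c₁) + (((1 + i) * c₁ + i * c₀) + (c₁ + c₀))
    ≡⟨ cong₂ (λ x y → x + (y + (c₁ + c₀))) (nC-absorb N (suc i)) (nC-absorb N i) ⟩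
  N * c₁ + (N * c₀ + (c₁ + c₀))
    ≡⟨ solve 3 (λ N c₀ c₁ → N :* c₁ :+ (N :* c₀ :+ (c₁ :+ c₀)) := (con 1 :+ N) :* (c₀ :+ c₁))
         refl N c₀ c₁ ⟩
  suc N * (c₀ + c₁) ∎
  where
  open ≡-Reasoning
  c₀ c₁ c₂ : ℕ
  c₀ = N C i
  c₁ = N C suc i
  c₂ = N C suc (suc i)

nC-growth : ∀ M N j → j + suc j * M ≤ N → M * (N C j) ≤ N C suc j
nC-growth M N j h = *-cancelˡ-≤ (suc j) (+-cancelʳ-≤ (j * c) _ _ (begin
  suc j * (M * c) + j * c  ≡⟨ solve 3 (λ j M c → (con 1 :+ j) :* (M :* c) :+ j :* c
                                := (j :+ (con 1 :+ j) :* M) :* c) refl j M c ⟩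
  (j + suc j * M) * c      ≤⟨ *-monoˡ-≤ c h ⟩
  N * c                    ≡⟨ nC-absorb N j ⟨
  suc j * (N C suc j) + j * c ∎))
  where
  open ≤-Reasoning
  c : ℕ
  c = N C j

-- Each term of index `j` on the left is matched with the term of index `suc j` on the right, by
-- `nC-growth`; the right side keeps `N C 0` as surplus. For large `N` this makes the sum up to
-- `suc e` beat any constant multiple of the sum up to `e`.
sumBinom-growth : ∀ M N e → e + suc e * M ≤ N → M * sumBinom N e ≤ sumBinom N (suc e)
sumBinom-growth M N zero    h = ≤-trans (nC-growth M N 0 h) (m≤m+n _ _)
sumBinom-growth M N (suc e) h = begin
  M * (N C suc e + sumBinom N e)       ≡⟨ *-distribˡ-+ M _ _ ⟩
  M * (N C suc e) + M * sumBinom N e   ≤⟨ +-mono-≤ (nC-growth M N (suc e) h)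
                                            (sumBinom-growth M N e (≤-trans (+-mono-≤ (n≤1+n e) (*-monoˡ-≤ M (n≤1+n (suc e)))) h)) ⟩
  N C suc (suc e) + sumBinom N (suc e) ∎
  where open ≤-Reasoning

-- Cardinalities of finite sets

∣p─q∣+∣p∩q∣≡∣p∣ : ∀ {n} (p q : Subset n) → ∣ p ─ q ∣ + ∣ p ∩ q ∣ ≡ ∣ p ∣
∣p─q∣+∣p∩q∣≡∣p∣ [] [] = refl
∣p─q∣+∣p∩q∣≡∣p∣ (outside ∷ p) (outside ∷ q) = ∣p─q∣+∣p∩q∣≡∣p∣ p q
∣p─q∣+∣p∩q∣≡∣p∣ (outside ∷ p) (inside ∷ q)  = ∣p─q∣+∣p∩q∣≡∣p∣ p q
∣p─q∣+∣p∩q∣≡∣p∣ (inside ∷ p)  (outside ∷ q) = cong suc (∣p─q∣+∣p∩q∣≡∣p∣ p q)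
∣p─q∣+∣p∩q∣≡∣p∣ (inside ∷ p)  (inside ∷ q)  = trans (+-suc _ _) (cong suc (∣p─q∣+∣p∩q∣≡∣p∣ p q))

∣p△q∣≡∣p─q∣+∣q─p∣ : ∀ {n} (p q : Subset n) → ∣ p △ q ∣ ≡ ∣ p ─ q ∣ + ∣ q ─ p ∣
∣p△q∣≡∣p─q∣+∣q─p∣ [] [] = refl
∣p△q∣≡∣p─q∣+∣q─p∣ (outside ∷ p) (outside ∷ q) = ∣p△q∣≡∣p─q∣+∣q─p∣ p q
∣p△q∣≡∣p─q∣+∣q─p∣ (outside ∷ p) (inside ∷ q)  = trans (cong suc (∣p△q∣≡∣p─q∣+∣q─p∣ p q)) (sym (+-suc _ _))
∣p△q∣≡∣p─q∣+∣q─p∣ (inside ∷ p)  (outside ∷ q) = cong suc (∣p△q∣≡∣p─q∣+∣q─p∣ p q)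
∣p△q∣≡∣p─q∣+∣q─p∣ (inside ∷ p)  (inside ∷ q)  = ∣p△q∣≡∣p─q∣+∣q─p∣ p q

∣p∪q∣≤∣p∣+∣q∣ : ∀ {n} (p q : Subset n) → ∣ p ∪ q ∣ ≤ ∣ p ∣ + ∣ q ∣
∣p∪q∣≤∣p∣+∣q∣ [] [] = z≤n
∣p∪q∣≤∣p∣+∣q∣ (outside ∷ p) (outside ∷ q) = ∣p∪q∣≤∣p∣+∣q∣ p q
∣p∪q∣≤∣p∣+∣q∣ (outside ∷ p) (inside ∷ q)  = ≤-trans (s≤s (∣p∪q∣≤∣p∣+∣q∣ p q)) (≤-reflexive (sym (+-suc _ _)))
∣p∪q∣≤∣p∣+∣q∣ (inside ∷ p)  (outside ∷ q) = s≤s (∣p∪q∣≤∣p∣+∣q∣ p q)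
∣p∪q∣≤∣p∣+∣q∣ (inside ∷ p)  (inside ∷ q)  = s≤s (≤-trans (∣p∪q∣≤∣p∣+∣q∣ p q) (+-monoʳ-≤ ∣ p ∣ (n≤1+n _)))

∣p─q∣≡∣p∣∸∣p∩q∣ : ∀ {n} (p q : Subset n) → ∣ p ─ q ∣ ≡ ∣ p ∣ ∸ ∣ p ∩ q ∣
∣p─q∣≡∣p∣∸∣p∩q∣ p q =
  trans (sym (m+n∸n≡m ∣ p ─ q ∣ ∣ p ∩ q ∣)) (cong (_∸ ∣ p ∩ q ∣) (∣p─q∣+∣p∩q∣≡∣p∣ p q))

∣p∩q─q∣≡0 : ∀ {n} (p q : Subset n) → ∣ (p ∩ q) ─ q ∣ ≡ 0
∣p∩q─q∣≡0 [] [] = refl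
∣p∩q─q∣≡0 (outside ∷ p) (outside ∷ q) = ∣p∩q─q∣≡0 p q
∣p∩q─q∣≡0 (outside ∷ p) (inside ∷ q)  = ∣p∩q─q∣≡0 p q
∣p∩q─q∣≡0 (inside ∷ p)  (outside ∷ q) = ∣p∩q─q∣≡0 p q
∣p∩q─q∣≡0 (inside ∷ p)  (inside ∷ q)  = ∣p∩q─q∣≡0 p q

∩-monoʳ-⊆ : ∀ {n} (p : Subset n) {q r} → q ⊆ r → p ∩ q ⊆ p ∩ r
∩-monoʳ-⊆ p {q} q⊆r x∈ with x∈p , x∈q ← x∈p∩q⁻ p q x∈ = x∈p∩q⁺ (x∈p , q⊆r x∈q)

∣p─q∣-antitone : ∀ {n} (p : Subset n) {q r} → q ⊆ r → ∣ p ─ r ∣ ≤ ∣ p ─ q ∣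
∣p─q∣-antitone p {q} {r} q⊆r rewrite ∣p─q∣≡∣p∣∸∣p∩q∣ p q | ∣p─q∣≡∣p∣∸∣p∩q∣ p r =
  ∸-monoʳ-≤ ∣ p ∣ (p⊆q⇒∣p∣≤∣q∣ (∩-monoʳ-⊆ p q⊆r))

⊆⊎∉ : ∀ {n} (p q : Subset n) → p ⊆ q ⊎ ∃ λ x → x ∈ˢ p × x ∉ˢ q
⊆⊎∉ p q with any? (λ x → (x ∈? p) ×-dec ¬? (x ∈? q))
... | yes w = inj₂ w
... | no ¬w = inj₁ λ {x} x∈p → decidable-stable (x ∈? q) λ x∉q → ¬w (x , x∈p , x∉q)

∣p─q∣≡0⇒p⊆q : ∀ {n} (p q : Subset n) → ∣ p ─ q ∣ ≡ 0 → p ⊆ q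
∣p─q∣≡0⇒p⊆q p q eq with ⊆⊎∉ p q
... | inj₁ p⊆q = p⊆q
... | inj₂ (x , x∈p , x∉q) = ⊥-elim (<-irrefl eq₁ (p⊂q⇒∣p∣<∣q∣ (p∩q⊆p p q , x , x∈p , x∉q ∘ proj₂ ∘ x∈p∩q⁻ p q)))
  where
  eq₁ : ∣ p ∩ q ∣ ≡ ∣ p ∣
  eq₁ = trans (sym (cong (_+ ∣ p ∩ q ∣) eq)) (∣p─q∣+∣p∩q∣≡∣p∣ p q)

-- Enumerating the sets close to a fixed one

-- Induction on `xs`: one occurrence of the head is cut out of `ys`, and by uniqueness the tail
-- still lies in what remains.
Unique-⊆⇒length≤ : ∀ {A : Set} {xs ys : List A} → Unique xs → (∀ {x} → x ∈ xs → x ∈ ys) → length xs ≤ length ys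
Unique-⊆⇒length≤ [] _ = z≤n
Unique-⊆⇒length≤ {xs = x ∷ xs} (x∉xs ∷ u) xs⊆ys with us , vs , refl ← ∈-∃++ (xs⊆ys (here refl)) = begin
  suc (length xs)                ≤⟨ s≤s (Unique-⊆⇒length≤ u xs⊆us++vs) ⟩
  suc (length (us ++ vs))        ≡⟨ cong suc (length-++ us) ⟩
  suc (length us + length vs)    ≡⟨ +-suc _ _ ⟨
  length us + suc (length vs)    ≡⟨ length-++ us ⟨
  length (us ++ x ∷ vs)          ∎
  where
  open ≤-Reasoning
  xs⊆us++vs : ∀ {y} → y ∈ xs → y ∈ us ++ vs
  xs⊆us++vs y∈xs with ∈-++⁻ us (xs⊆ys (there y∈xs))
  ... | inj₁ y∈us         = ∈-++⁺ˡ y∈us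
  ... | inj₂ (here refl)  = ⊥-elim (All.lookup x∉xs y∈xs refl)
  ... | inj₂ (there y∈vs) = ∈-++⁺ʳ us y∈vs

-- Lists the B ⊇ L with at most e elements outside L ∪ W.
near : ∀ {n} → Subset n → Subset n → ℕ → List (Subset n)
near []            []            e       = [] ∷ []
near (inside ∷ L)  (_ ∷ W)       e       = map (inside ∷_) (near L W e)
near (outside ∷ L) (inside ∷ W)  e       = map (outside ∷_) (near L W e) ++ map (inside ∷_) (near L W e)
near (outside ∷ L) (outside ∷ W) zero    = map (outside ∷_) (near L W zero)
near (outside ∷ L) (outside ∷ W) (suc e) = map (outside ∷_) (near L W (suc e)) ++ map (inside ∷_) (near L W e)

∈-near : ∀ {n} (L W : Subset n) e {B} → L ⊆ B → ∣ B ─ L ─ W ∣ ≤ e → B ∈ near L W e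
∈-near [] [] e {[]} _ _ = here refl
∈-near (inside ∷ L) (_ ∷ W) e {outside ∷ B} L⊆B h with () ← L⊆B here
∈-near (inside ∷ L) (inside ∷ W) e {inside ∷ B} L⊆B h = ∈-map⁺ _ (∈-near L W e (drop-∷-⊆ L⊆B) h)
∈-near (inside ∷ L) (outside ∷ W) e {inside ∷ B} L⊆B h = ∈-map⁺ _ (∈-near L W e (drop-∷-⊆ L⊆B) h)
∈-near (outside ∷ L) (inside ∷ W) e {outside ∷ B} L⊆B h = ∈-++⁺ˡ (∈-map⁺ _ (∈-near L W e (drop-∷-⊆ L⊆B) h))
∈-near (outside ∷ L) (inside ∷ W) e {inside ∷ B} L⊆B h = ∈-++⁺ʳ _ (∈-map⁺ _ (∈-near L W e (drop-∷-⊆ L⊆B) h))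
∈-near (outside ∷ L) (outside ∷ W) zero {outside ∷ B} L⊆B h = ∈-map⁺ _ (∈-near L W zero (drop-∷-⊆ L⊆B) h)
∈-near (outside ∷ L) (outside ∷ W) (suc e) {outside ∷ B} L⊆B h = ∈-++⁺ˡ (∈-map⁺ _ (∈-near L W (suc e) (drop-∷-⊆ L⊆B) h))
∈-near (outside ∷ L) (outside ∷ W) (suc e) {inside ∷ B} L⊆B (s≤s h) = ∈-++⁺ʳ _ (∈-map⁺ _ (∈-near L W e (drop-∷-⊆ L⊆B) h))

length-map-++-map : ∀ {A B : Set} (f g : A → B) xs ys → length (map f xs ++ map g ys) ≡ length xs + length ys
length-map-++-map f g xs ys = trans (length-++ (map f xs)) (cong₂ _+_ (length-map f xs) (length-map g ys))

-- Every element of `W` outside `L` is free and contributes a factor 2; choosing at most `e` further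
-- elements follows `sumBinom-pascal`. Counting these among all of `∁ L` instead of the complement
-- of `L ∪ W` is generous but enough.
length-near : ∀ {n} (L W : Subset n) e → length (near L W e) ≤ 2 ^ ∣ W ∣ * sumBinom ∣ ∁ L ∣ e
length-near [] [] zero = s≤s z≤n
length-near [] [] (suc e) = ≤-trans (length-near [] [] e) (*-monoʳ-≤ 1 (sumBinom-monoʳ 0 e))
length-near (inside ∷ L) (outside ∷ W) e =
  ≤-trans (≤-reflexive (length-map _ (near L W e))) (length-near L W e)
length-near (inside ∷ L) (inside ∷ W) e =
  ≤-trans (≤-reflexive (length-map _ (near L W e))) (≤-trans (length-near L W e) (*-monoˡ-≤ (sumBinom ∣ ∁ L ∣ e) (m≤m+n (2 ^ ∣ W ∣) _)))
length-near (outside ∷ L) (inside ∷ W) e = begin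
  length (near (outside ∷ L) (inside ∷ W) e)      ≡⟨ length-map-++-map _ _ (near L W e) (near L W e) ⟩
  length (near L W e) + length (near L W e)       ≤⟨ +-mono-≤ ih ih ⟩
  X + X                                           ≡⟨ solve 2 (λ p s → p :* s :+ p :* s := con 2 :* p :* s) refl (2 ^ ∣ W ∣) _ ⟩
  2 ^ suc ∣ W ∣ * sumBinom (suc ∣ ∁ L ∣) e        ∎
  where
  open ≤-Reasoning
  X : ℕ
  X = 2 ^ ∣ W ∣ * sumBinom (suc ∣ ∁ L ∣) e
  ih : length (near L W e) ≤ X
  ih = ≤-trans (length-near L W e) (*-monoʳ-≤ (2 ^ ∣ W ∣) (sumBinom-suc-mono ∣ ∁ L ∣ e))
length-near (outside ∷ L) (outside ∷ W) zero =
  ≤-trans (≤-reflexive (length-map _ (near L W zero)))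
    (≤-trans (length-near L W zero) (*-monoʳ-≤ (2 ^ ∣ W ∣) (sumBinom-suc-mono ∣ ∁ L ∣ zero)))
length-near (outside ∷ L) (outside ∷ W) (suc e) = begin
  length (near (outside ∷ L) (outside ∷ W) (suc e))  ≡⟨ length-map-++-map _ _ (near L W (suc e)) (near L W e) ⟩
  length (near L W (suc e)) + length (near L W e)    ≤⟨ +-mono-≤ (length-near L W (suc e)) (length-near L W e) ⟩
  2 ^ ∣ W ∣ * sumBinom N (suc e) + 2 ^ ∣ W ∣ * sumBinom N e
                                                     ≡⟨ *-distribˡ-+ (2 ^ ∣ W ∣) _ _ ⟨
  2 ^ ∣ W ∣ * (sumBinom N (suc e) + sumBinom N e)    ≡⟨ cong (2 ^ ∣ W ∣ *_) (sumBinom-pascal N e) ⟨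
  2 ^ ∣ W ∣ * sumBinom (suc N) (suc e)               ∎
  where
  open ≤-Reasoning
  N : ℕ
  N = ∣ ∁ L ∣

length≤near : ∀ {n} {F : List (Subset n)} (L W : Subset n) e → Unique F →
  (∀ {B} → B ∈ F → L ⊆ B × ∣ B ─ L ─ W ∣ ≤ e) →
  length F ≤ 2 ^ ∣ W ∣ * sumBinom (n ∸ ∣ L ∣) e
length≤near L W e u h = begin
  _                                ≤⟨ Unique-⊆⇒length≤ u (λ B∈F → ∈-near L W e (proj₁ (h B∈F)) (proj₂ (h B∈F))) ⟩
  length (near L W e)              ≤⟨ length-near L W e ⟩
  2 ^ ∣ W ∣ * sumBinom ∣ ∁ L ∣ e   ≡⟨ cong (λ x → 2 ^ ∣ W ∣ * sumBinom x e) (∣∁p∣≡n∸∣p∣ L) ⟩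
  _ ∎
  where open ≤-Reasoning

length≤near⊥ˡ : ∀ {n} {F : List (Subset n)} (W : Subset n) e → Unique F →
  (∀ {B} → B ∈ F → ∣ B ─ W ∣ ≤ e) → length F ≤ 2 ^ ∣ W ∣ * sumBinom n e
length≤near⊥ˡ {n} {F} W e u h = subst (λ x → length F ≤ 2 ^ ∣ W ∣ * sumBinom (n ∸ x) e) (∣⊥∣≡0 n)
  (length≤near ⊥ W e u λ {B} B∈F → ⊥⊆ , subst (λ x → ∣ x ─ W ∣ ≤ e) (sym (p─⊥≡p B)) (h B∈F))

length≤near⊥ʳ : ∀ {n} {F : List (Subset n)} (L : Subset n) e → Unique F →
  (∀ {B} → B ∈ F → L ⊆ B × ∣ B ─ L ∣ ≤ e) → length F ≤ sumBinom (n ∸ ∣ L ∣) e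
length≤near⊥ʳ {n} {F} L e u h = begin
  length F                                   ≤⟨ length≤near L ⊥ e u (λ {B} B∈F → proj₁ (h B∈F) , ≤-trans (∣p─q∣≤∣p∣ (B ─ L) ⊥) (proj₂ (h B∈F))) ⟩
  2 ^ ∣ ⊥ {n} ∣ * sumBinom (n ∸ ∣ L ∣) e     ≡⟨ cong (λ x → 2 ^ x * sumBinom (n ∸ ∣ L ∣) e) (∣⊥∣≡0 n) ⟩
  1 * sumBinom (n ∸ ∣ L ∣) e                 ≡⟨ *-identityˡ _ ⟩
  sumBinom (n ∸ ∣ L ∣) e                     ∎
  where open ≤-Reasoning

-- A single family

module _ {n t k : ℕ} (t≤k : t ≤ k) (F : List (Subset n))
  (size : ∀ {A} → A ∈ F → ∣ A ∣ ≤ k)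
  (close : ∀ {A B} → A ∈ F → B ∈ F → ∣ A ∩ B ∣ < t → ∣ A △ B ∣ ≤ k ∸ t) where

  -- If the intersection is smaller than `t`, the difference is part of `A △ B`; otherwise at least
  -- `t` of the at most `k` elements of `B` lie in `A`.
  ∣B─A∣≤k∸t : ∀ {A B} → A ∈ F → B ∈ F → ∣ B ─ A ∣ ≤ k ∸ t
  ∣B─A∣≤k∸t {A} {B} A∈F B∈F with t ≤? ∣ A ∩ B ∣
  ... | no ≱t = begin
    ∣ B ─ A ∣             ≤⟨ m≤n+m _ _ ⟩
    ∣ A ─ B ∣ + ∣ B ─ A ∣ ≡⟨ ∣p△q∣≡∣p─q∣+∣q─p∣ A B ⟨
    ∣ A △ B ∣             ≤⟨ close A∈F B∈F (≰⇒> ≱t) ⟩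
    k ∸ t                 ∎
    where open ≤-Reasoning
  ... | yes t≤ = m+n≤o⇒m≤o∸n ∣ B ─ A ∣ (begin
    ∣ B ─ A ∣ + t          ≤⟨ +-monoʳ-≤ ∣ B ─ A ∣ (subst (λ x → t ≤ ∣ x ∣) (∩-comm A B) t≤) ⟩
    ∣ B ─ A ∣ + ∣ B ∩ A ∣  ≡⟨ ∣p─q∣+∣p∩q∣≡∣p∣ B A ⟩
    ∣ B ∣                  ≤⟨ size B∈F ⟩
    k ∎)
    where open ≤-Reasoning

  full-intersects : ∀ {A B} → A ∈ F → B ∈ F → ∣ B ∣ ≡ k → t ≤ ∣ B ∩ A ∣
  full-intersects {A} {B} A∈F B∈F full = +-cancelˡ-≤ (k ∸ t) t ∣ B ∩ A ∣ (begin
    k ∸ t + t              ≡⟨ m∸n+n≡m t≤k ⟩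
    k                      ≡⟨ full ⟨
    ∣ B ∣                  ≡⟨ ∣p─q∣+∣p∩q∣≡∣p∣ B A ⟨
    ∣ B ─ A ∣ + ∣ B ∩ A ∣  ≤⟨ +-monoˡ-≤ ∣ B ∩ A ∣ (∣B─A∣≤k∸t A∈F B∈F) ⟩
    k ∸ t + ∣ B ∩ A ∣      ∎)
    where open ≤-Reasoning

  -- Suppose `∣ B ─ A ∣` attains `k ∸ t`. An intersection of size at least `t` would give `B` at
  -- least `k` elements. So `close` applies, and `B ─ A` already exhausts its bound on `A △ B`: this
  -- leaves `A ─ B` empty, whence the exact size of `B`.
  small-dichotomy : ∀ {A B} → A ∈ F → B ∈ F → ∣ B ∣ < k →
    ∣ B ─ A ∣ < k ∸ t ⊎ ∣ B ∣ ≡ k ∸ t + ∣ A ∣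
  small-dichotomy {A} {B} A∈F B∈F small with t ≤? ∣ A ∩ B ∣ | ∣ B ─ A ∣ <? k ∸ t
  ... | _      | yes lt = inj₁ lt
  ... | yes t≤ | no ≮ = ⊥-elim (≮ (m+n≤o⇒m≤o∸n (suc ∣ B ─ A ∣) (begin
    suc (∣ B ─ A ∣ + t)         ≤⟨ s≤s (+-monoʳ-≤ ∣ B ─ A ∣ (subst (λ x → t ≤ ∣ x ∣) (∩-comm A B) t≤)) ⟩
    suc (∣ B ─ A ∣ + ∣ B ∩ A ∣) ≡⟨ cong suc (∣p─q∣+∣p∩q∣≡∣p∣ B A) ⟩
    suc ∣ B ∣                   ≤⟨ small ⟩
    k ∎)))
    where open ≤-Reasoning
  ... | no ≱t  | no ≮ = inj₂ (begin
    ∣ B ∣                            ≡⟨ ∣p─q∣+∣p∩q∣≡∣p∣ B A ⟨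
    ∣ B ─ A ∣ + ∣ B ∩ A ∣            ≡⟨ cong₂ _+_ (≤-antisym (∣B─A∣≤k∸t A∈F B∈F) (≮⇒≥ ≮)) (cong ∣_∣ (∩-comm B A)) ⟩
    k ∸ t + ∣ A ∩ B ∣                ≡⟨ cong (λ x → k ∸ t + (x + ∣ A ∩ B ∣)) A─B≡0 ⟨
    k ∸ t + (∣ A ─ B ∣ + ∣ A ∩ B ∣)  ≡⟨ cong (k ∸ t +_) (∣p─q∣+∣p∩q∣≡∣p∣ A B) ⟩
    k ∸ t + ∣ A ∣                    ∎)
    where
    open ≡-Reasoning
    A─B≡0 : ∣ A ─ B ∣ ≡ 0
    A─B≡0 = n≤0⇒n≡0 (+-cancelʳ-≤ ∣ B ─ A ∣ ∣ A ─ B ∣ 0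
      (≤-trans (≤-reflexive (sym (∣p△q∣≡∣p─q∣+∣q─p∣ A B)))
        (≤-trans (close A∈F B∈F (≰⇒> ≱t)) (≮⇒≥ ≮))))

  CommonCore : Set
  CommonCore = ∃ λ T → t ≤ ∣ T ∣ × All (T ⊆_) F

  -- The guard `t ≤ ∣ T ∣` excuses traces too small to be a common core; the trace on `A₀` of a
  -- member of size `k` always passes it.
  Avoiding : Subset n → Subset n → Set
  Avoiding W T = t ≤ ∣ T ∣ → ∃ λ A → A ∈ F × A ⊆ W × ∃ λ x → x ∈ˢ T × x ∉ˢ A

  -- For each candidate `T` of size at least `t`, either all members contain it and it is a core, or
  -- some member `A` omits one of its elements. `W` is the union of these `A`, at most one per
  -- candidate.
  core⊎avoiding : (Ts : List (Subset n)) →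
    CommonCore ⊎ ∃ λ W → ∣ W ∣ ≤ length Ts * k × (∀ {T} → T ∈ Ts → Avoiding W T)
  core⊎avoiding [] = inj₂ (⊥ , ≤-reflexive (∣⊥∣≡0 n) , λ ())
  core⊎avoiding (T ∷ Ts) with core⊎avoiding Ts
  ... | inj₁ core = inj₁ core
  ... | inj₂ (W , ∣W∣≤ , avoid) with t ≤? ∣ T ∣ | All.decide (⊆⊎∉ T) F
  ...   | no t≰  | _ = inj₂ (W , m≤n⇒m≤o+n k ∣W∣≤ , λ { (here refl) t≤ → ⊥-elim (t≰ t≤) ; (there T∈) → avoid T∈ })
  ...   | yes t≤ | inj₁ all = inj₁ (T , t≤ , all)
  ...   | yes t≤ | inj₂ some with A , A∈F , x , x∈T , x∉A ← find some =
    inj₂ ( A ∪ W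
         , ≤-trans (∣p∪q∣≤∣p∣+∣q∣ A W) (+-mono-≤ (size A∈F) ∣W∣≤)
         , λ { (here refl) _ → A , A∈F , p⊆p∪q W , x , x∈T , x∉A
             ; (there T∈) t≤T → let A′ , A′∈F , A′⊆W , w = avoid T∈ t≤T
                                in A′ , A′∈F , ⊆-trans A′⊆W (q⊆p∪q A W) , w })

  core-bound : Unique F → CommonCore → length F ≤ sumBinom (n ∸ t) (k ∸ t)
  core-bound u (T , t≤ , T⊆) = ≤-trans
    (length≤near⊥ʳ T (k ∸ t) u λ {B} B∈F → All.lookup T⊆ B∈F , m+n≤o⇒m≤o∸n ∣ B ─ T ∣ (begin
      ∣ B ─ T ∣ + t          ≤⟨ +-monoʳ-≤ ∣ B ─ T ∣ (≤-trans t≤ (p⊆q⇒∣p∣≤∣q∣ λ x∈T → x∈p∩q⁺ (All.lookup T⊆ B∈F x∈T , x∈T))) ⟩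
      ∣ B ─ T ∣ + ∣ B ∩ T ∣  ≡⟨ ∣p─q∣+∣p∩q∣≡∣p∣ B T ⟩
      ∣ B ∣                  ≤⟨ size B∈F ⟩
      k ∎))
    (sumBinom-monoˡ (k ∸ t) (∸-monoʳ-≤ n t≤))
    where open ≤-Reasoning

  -- In the bound on `∣ W ∣`, the two summands `k` pay for `A₀` and `A₁`; `2 ^ k * k` pays for one
  -- member of `F` per subset of `A₀`.
  core⊎cover : 0 < k ∸ t → ∀ {A₀} → A₀ ∈ F →
    CommonCore ⊎ ∃ λ W → ∣ W ∣ ≤ k + (k + 2 ^ k * k) × (∀ {B} → B ∈ F → ∣ B ─ W ∣ < k ∸ t)
  -- With nothing prescribed and no element allowed outside `A₀`, `near ⊥ A₀ 0` contains every
  -- subset of `A₀`, hence every possible trace.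
  core⊎cover 0<d {A₀} A₀∈F with core⊎avoiding (near ⊥ A₀ 0)
  ... | inj₁ core = inj₁ core
  ... | inj₂ (V , ∣V∣≤ , avoid) = inj₂ (W , ∣W∣≤ , covers)
    where
    Enlarged : Subset n → Set
    Enlarged B = ∣ B ∣ ≡ k ∸ t + ∣ A₀ ∣

    -- A₁ = A₀ is a dummy when F has no enlarged member.
    enlarged : ∃ λ A₁ → A₁ ∈ F × (∀ {B} → B ∈ F → Enlarged B → Enlarged A₁)
    enlarged with Any.any? (λ B → ∣ B ∣ ≟ k ∸ t + ∣ A₀ ∣) F
    ... | yes some with A₁ , A₁∈F , e ← find some = A₁ , A₁∈F , λ _ _ → e
    ... | no none = A₀ , A₀∈F , λ B∈F e → ⊥-elim (none (Any.map (λ { refl → e }) B∈F))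

    A₁ : Subset n
    A₁ = proj₁ enlarged

    A₁∈F : A₁ ∈ F
    A₁∈F = proj₁ (proj₂ enlarged)

    W : Subset n
    W = A₀ ∪ (A₁ ∪ V)

    A₀⊆W : A₀ ⊆ W
    A₀⊆W = p⊆p∪q (A₁ ∪ V)

    A₁⊆W : A₁ ⊆ W
    A₁⊆W = ⊆-trans (p⊆p∪q V) (q⊆p∪q A₀ (A₁ ∪ V))

    V⊆W : V ⊆ W
    V⊆W = ⊆-trans (q⊆p∪q A₁ V) (q⊆p∪q A₀ (A₁ ∪ V))

    traces≤ : length (near ⊥ A₀ 0) ≤ 2 ^ k
    traces≤ = begin
      length (near ⊥ A₀ 0)                   ≤⟨ length-near ⊥ A₀ 0 ⟩
      2 ^ ∣ A₀ ∣ * sumBinom ∣ ∁ (⊥ {n}) ∣ 0  ≡⟨ cong (2 ^ ∣ A₀ ∣ *_) (nC0≡1 ∣ ∁ (⊥ {n}) ∣) ⟩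
      2 ^ ∣ A₀ ∣ * 1                         ≡⟨ *-identityʳ _ ⟩
      2 ^ ∣ A₀ ∣                             ≤⟨ ^-monoʳ-≤ 2 (size A₀∈F) ⟩
      2 ^ k                                  ∎
      where open ≤-Reasoning

    ∣W∣≤ : ∣ W ∣ ≤ k + (k + 2 ^ k * k)
    ∣W∣≤ = begin
      ∣ W ∣                         ≤⟨ ∣p∪q∣≤∣p∣+∣q∣ A₀ (A₁ ∪ V) ⟩
      ∣ A₀ ∣ + ∣ A₁ ∪ V ∣           ≤⟨ +-monoʳ-≤ ∣ A₀ ∣ (∣p∪q∣≤∣p∣+∣q∣ A₁ V) ⟩
      ∣ A₀ ∣ + (∣ A₁ ∣ + ∣ V ∣)     ≤⟨ +-mono-≤ (size A₀∈F) (+-mono-≤ (size A₁∈F)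
                                         (≤-trans ∣V∣≤ (*-monoˡ-≤ k traces≤))) ⟩
      k + (k + 2 ^ k * k)           ∎
      where open ≤-Reasoning

    covers-small : ∀ {B} → B ∈ F → ∣ B ∣ < k → ∣ B ─ W ∣ < k ∸ t
    covers-small {B} B∈F small with small-dichotomy A₀∈F B∈F small | small-dichotomy A₁∈F B∈F small
    ... | inj₁ lt | _       = ≤-<-trans (∣p─q∣-antitone B A₀⊆W) lt
    ... | inj₂ _  | inj₁ lt = ≤-<-trans (∣p─q∣-antitone B A₁⊆W) lt
    -- Here `B` is enlarged over `A₀`, so `A₁` has the same size as `B`; but `e₁` makes `B` larger
    -- than `A₁` by `k ∸ t`, which is positive.
    ... | inj₂ e₀ | inj₂ e₁ = ⊥-elim (<-irrefl (trans (proj₂ (proj₂ enlarged) B∈F e₀) (trans (sym e₀) e₁))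
                                (+-monoˡ-≤ ∣ A₁ ∣ 0<d))

    covers-full : ∀ {B} → B ∈ F → ∣ B ∣ ≡ k → ∣ B ─ W ∣ < k ∸ t
    covers-full {B} B∈F full
      with A , A∈F , A⊆V , x , x∈T , x∉A ← avoid {B ∩ A₀}
             (∈-near ⊥ A₀ 0 ⊥⊆ (≤-reflexive
               (trans (cong (λ p → ∣ p ─ A₀ ∣) (p─⊥≡p (B ∩ A₀))) (∣p∩q─q∣≡0 B A₀))))
             (full-intersects A₀∈F B∈F full)
      = m+n≤o⇒m≤o∸n (suc ∣ B ─ W ∣) (begin
        suc (∣ B ─ W ∣ + t)    ≡⟨ +-suc _ _ ⟨
        -- `B ∩ A` already has `t` elements, and `x` lies in `B ∩ A₀` but not in `A`. Both `A` and
        -- `A₀` are inside `W`, so `B ∩ W` has at least `suc t`.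
        ∣ B ─ W ∣ + suc t      ≤⟨ +-monoʳ-≤ ∣ B ─ W ∣ (≤-<-trans (full-intersects A∈F B∈F full) (p⊂q⇒∣p∣<∣q∣
                                    ( ∩-monoʳ-⊆ B (⊆-trans A⊆V V⊆W)
                                    , x , ∩-monoʳ-⊆ B A₀⊆W x∈T , x∉A ∘ p∩q⊆q B A))) ⟩
        ∣ B ─ W ∣ + ∣ B ∩ W ∣  ≡⟨ ∣p─q∣+∣p∩q∣≡∣p∣ B W ⟩
        ∣ B ∣                  ≡⟨ full ⟩
        k ∎)
      where
      open ≤-Reasoning

    covers : ∀ {B} → B ∈ F → ∣ B ─ W ∣ < k ∸ t
    covers {B} B∈F with ∣ B ∣ <? k
    ... | yes small = covers-small B∈F small
    ... | no ≮k     = covers-full B∈F (≤-antisym (size B∈F) (≮⇒≥ ≮k))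

-- The threshold for n and the bound for one family

coverSize : ℕ → ℕ
coverSize k = k + (k + 2 ^ k * k)

coverSize-mono : ∀ {k b} → k ≤ b → coverSize k ≤ coverSize b
coverSize-mono k≤b = +-mono-≤ k≤b (+-mono-≤ k≤b (*-mono-≤ (^-monoʳ-≤ 2 k≤b) k≤b))

-- The growth factor demanded is `2 ^ coverSize b` for the subsets of the cover times `2 ^ t` for
-- passing from `n` to `n ∸ t`. The rest is the hypothesis of `sumBinom-growth` at `e = b`, with the
-- final `t` added because it is applied to `n ∸ t`.
threshold : ℕ → ℕ → ℕ
threshold t b = b + suc b * (2 ^ coverSize b * 2 ^ t) + t

cover-bound : ∀ {t b n w e} → w ≤ coverSize b → e ≤ b → threshold t b ≤ n →
  2 ^ w * sumBinom n e ≤ sumBinom (n ∸ t) (suc e)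
cover-bound {t} {b} {n} {w} {e} w≤ e≤b n₀≤n = begin
  2 ^ w * sumBinom n e                       ≤⟨ *-monoˡ-≤ (sumBinom n e) (^-monoʳ-≤ 2 w≤) ⟩
  P * sumBinom n e                           ≡⟨ cong (λ x → P * sumBinom x e) (m+[n∸m]≡n (m+n≤o⇒n≤o (b + suc b * (P * 2 ^ t)) n₀≤n)) ⟨
  P * sumBinom (t + (n ∸ t)) e               ≤⟨ *-monoʳ-≤ P (sumBinom-shift t (n ∸ t) e) ⟩
  P * (2 ^ t * sumBinom (n ∸ t) e)           ≡⟨ *-assoc P (2 ^ t) _ ⟨
  P * 2 ^ t * sumBinom (n ∸ t) e             ≤⟨ sumBinom-growth (P * 2 ^ t) (n ∸ t) e (≤-trans
                                                  (+-mono-≤ e≤b (*-monoˡ-≤ (P * 2 ^ t) (s≤s e≤b)))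
                                                  (m+n≤o⇒m≤o∸n _ n₀≤n)) ⟩
  sumBinom (n ∸ t) (suc e)                   ∎
  where
  open ≤-Reasoning
  P : ℕ
  P = 2 ^ coverSize b

family-bound : ∀ {t b k n} → t ≤ k → k ≤ b → threshold t b ≤ n → (F : List (Subset n)) → Unique F →
  (∀ {A} → A ∈ F → ∣ A ∣ ≤ k) →
  (∀ {A B} → A ∈ F → B ∈ F → ∣ A ∩ B ∣ < t → ∣ A △ B ∣ ≤ k ∸ t) →
  length F ≤ sumBinom (n ∸ t) (k ∸ t)
family-bound t≤k k≤b n₀≤n [] _ _ _ = z≤n
family-bound {t} {b} {k} {n} t≤k k≤b n₀≤n F@(A₀ ∷ _) u size close with k ∸ t ≟ 0
-- When `k ∸ t` is zero, any two members have empty differences both ways, so every member equals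
-- `A₀`; the count takes `A₀` as prescribed part with no extra elements.
... | yes d≡0 = begin
  length F                     ≤⟨ length≤near⊥ʳ A₀ 0 u (λ {B} B∈F →
                                     ∣p─q∣≡0⇒p⊆q A₀ B (n≤0⇒n≡0 (─≤0 B∈F (here refl))) , ─≤0 (here refl) B∈F) ⟩
  sumBinom (n ∸ ∣ A₀ ∣) 0      ≡⟨ nC0≡1 (n ∸ ∣ A₀ ∣) ⟩
  1                            ≡⟨ nC0≡1 (n ∸ t) ⟨
  sumBinom (n ∸ t) 0           ≡⟨ cong (sumBinom (n ∸ t)) d≡0 ⟨
  sumBinom (n ∸ t) (k ∸ t)     ∎
  where
  open ≤-Reasoning
  ─≤0 : ∀ {A B} → A ∈ F → B ∈ F → ∣ B ─ A ∣ ≤ 0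
  ─≤0 {A} {B} A∈F B∈F = subst (∣ B ─ A ∣ ≤_) d≡0 (∣B─A∣≤k∸t t≤k F size close A∈F B∈F)
... | no d≢0 with core⊎cover t≤k F size close (n≢0⇒n>0 d≢0) {A₀} (here refl)
...   | inj₁ core = core-bound t≤k F size close u core
...   | inj₂ (W , ∣W∣≤ , covers) = begin
  -- The strict inequality in `covers` lowers the number of elements outside `W` to `k ∸ t ∸ 1`, one
  -- less than in the target sum; `cover-bound` exploits this gap.
  length F                                   ≤⟨ length≤near⊥ˡ W (k ∸ t ∸ 1) u (λ B∈F → ∸-monoˡ-≤ 1 (covers B∈F)) ⟩
  2 ^ ∣ W ∣ * sumBinom n (k ∸ t ∸ 1)         ≤⟨ cover-bound (≤-trans ∣W∣≤ (coverSize-mono k≤b))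
                                                  (≤-trans (m∸n≤m (k ∸ t) 1) (≤-trans (m∸n≤m k t) k≤b)) n₀≤n ⟩
  sumBinom (n ∸ t) (suc (k ∸ t ∸ 1))         ≡⟨ cong (sumBinom (n ∸ t)) (m+[n∸m]≡n (n≢0⇒n>0 d≢0)) ⟩
  sumBinom (n ∸ t) (k ∸ t)                   ∎
  where open ≤-Reasoning

-- From single families to the product

prodFin-mono : ∀ {r} {f g : Fin r → ℕ} → (∀ i → f i ≤ g i) → prodFin f ≤ prodFin g
prodFin-mono {zero}  h = ≤-refl
prodFin-mono {suc r} h = *-mono-≤ (h zero) (prodFin-mono (h ∘ fsuc))

first≤ : ∀ {m} (k : Fin (suc m) → ℕ) → (∀ i → k (inject₁ i) ≤ k (fsuc i)) → ∀ i → k zero ≤ k i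
first≤ k step zero = ≤-refl
first≤ {suc m} k step (fsuc i) = ≤-trans (step zero) (first≤ (k ∘ fsuc) (step ∘ fsuc) i)

≤last : ∀ {m} (k : Fin (suc m) → ℕ) → (∀ i → k (inject₁ i) ≤ k (fsuc i)) → ∀ i → k i ≤ k (fromℕ m)
≤last {m} k step zero = first≤ k step (fromℕ m)
≤last {suc m} k step (fsuc i) = ≤last (k ∘ fsuc) (step ∘ fsuc) i

theorem1p4 : (t a b : ℕ) → Σ ℕ λ n₀ →
    (m : ℕ) (k : Fin (suc (suc m)) → ℕ) (n : ℕ) →
    k (inject₁ (fromℕ m)) ≡ a → k (fromℕ (suc m)) ≡ b →
    1 ≤ t → t ≤ k zero → (∀ i → k (inject₁ i) ≤ k (fsuc i)) → b ≤ n →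
    n₀ ≤ n →
    (F : Fin (suc (suc m)) → List (Subset n)) →
    (∀ i → Unique (F i)) →
    (∀ i → ∀ A → A ∈ F i → ∣ A ∣ ≤ k i) →
    (∀ i j → ∀ A B → A ∈ F i → B ∈ F j → ∣ A ∩ B ∣ < t → ∣ A △ B ∣ ≤ (k i ⊓ k j) ∸ t) →
    prodFin (λ i → length (F i)) ≤ prodFin (λ i → sumBinom (n ∸ t) (k i ∸ t))
-- Since the `k i` increase to `b`, one threshold in `t` and `b` serves all families at once.
theorem1p4 t a b = threshold t b , λ m k n _ last 1≤t t≤k₀ step b≤n n₀≤n F unique size close →
  prodFin-mono λ i → family-bound
    (≤-trans t≤k₀ (first≤ k step i))
    (≤-trans (≤last k step i) (≤-reflexive last))
    n₀≤n (F i) (unique i)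
    (λ {A} → size i A)
    -- At `j = i` the minimum collapses to `k i`, giving the form that `family-bound` expects.
    (λ {A} {B} A∈F B∈F lt → ≤-trans (close i i A B A∈F B∈F lt) (≤-reflexive (cong (_∸ t) (⊓-idem (k i)))))
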